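{- Let $l,m,n$ be non-negative integers. For a fixed partition $\kappa\subset\langle(m+n)^l\rangle$, there is a 1-to-1 correspondence between the sets (1) $\{(\mu,\nu):\mu\star_{m,n}\nu=\kappa'\}$ (pairs of partitions of length at most $m$ and $n$, respectively, whose $(m,n)$-overlap is $\kappa'$), and (2) $\{(\lambda,K):\lambda\subset\langle m^{n+l}\rangle,\ K\subset[n+l],\ l(K)=l\text{ and }\mathrm{sub}_{n+l}(\lambda,K)=\kappa\}$ (pairs consisting of a partition $\lambda$ and a subsequence $K$), given by the mapping from (2) to (1) $$(\lambda,K)\mapsto\left(\lambda',\ \mathrm{sub}_{n+l}\left(\tilde\lambda,C_{n+l}(K)\right)\right),$$ where $\tilde\lambda$ is the $(m,n+l)$-complement of $\lambda$.
   Context: A partition is a non-increasing sequence of non-negative integers; partitions differing only by trailing zeros are equal; its length is the number of positive parts, and $\lambda'$ is its conjugate. When used as a sequence of prescribed length, a partition is padded with zeros. $\langle m^n\rangle=(m,\dots,m)$ ($n$ entries); $\lambda\subset\langle m^n\rangle$ means containment of Ferrers diagrams, i.e. $\lambda$ has length at most $n$ and parts at most $m$. Sums of sequences are elementwise, and the union of two sequences is obtained by appending the second to the first. $[N]=(1,\dots,N)$; a subsequence $K\subset[N]$ is an increasing sequence of elements of $[N]$, of length $l(K)$. Complement: for $\lambda\subset\langle m^N\rangle$, the $(m,N)$-complement is $\tilde\lambda=(m-\lambda_N,\dots,m-\lambda_1)$. Subpartition: for a partition $\lambda$ of length at most $N$ and a subsequence $M\subset[N]$, $\mathrm{sub}_N(\lambda,M)$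 is the partition $\mu$ of length at most $l(M)$ with $\mu_j+l(M)-j=\lambda_{M_j}+N-M_j$ for all $1\le j\le l(M)$. For $K\subset[N]$, $C_N(K)$ is the subsequence of $[N]$ consisting (in increasing order) of the elements $N-j+1$ with $j\in[N]$, $j\notin K$. Overlap: $\rho_n=(n-1,\dots,1,0)$ ($\rho_0$ is empty). For partitions $\mu,\nu$ of length at most $m$ and $n$, respectively, the $(m,n)$-overlap $\mu\star_{m,n}\nu$ is the partition (of length at most $m+n$) such that $\mu\star_{m,n}\nu+\rho_{m+n}$ equals $(\mu+\rho_m)\cup(\nu+\rho_n)$ up to reordering, if it exists; otherwise $\mu\star_{m,n}\nu=\infty$, a symbol that is not a partition. -}

module Defs where

open import Data.Fin.Base as Fin using (Fin; toℕ; opposite)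
open import Data.Fin.Properties as Fin using (toℕ<n; opposite-prop)
open import Data.List.Base
  using (List; []; _∷_; _++_; map; length; filter; replicate; zipWith; applyUpTo; applyDownFrom; downFrom; allFin)
open import Data.List.Properties using (length-filter; length-++; length-zipWith; length-applyUpTo; length-downFrom)
open import Data.List.Membership.DecPropositional using (_∈?_)
open import Data.List.Relation.Binary.Permutation.Propositional using (_↭_; ↭-sym; ↭-trans; ↭-reflexive; ↭⇒↭ₛ)
open import Data.List.Relation.Binary.Permutation.Propositional.Properties using (↭-length)
open import Data.List.Relation.Binary.Pointwise using (Pointwise-≡⇒≡)
open import Data.List.Relation.Binary.Sublist.Propositional using (⊆-refl)
open import Data.List.Relation.Binary.Sublist.Propositional.Properties using (length-mono-≤)
import Data.List.Relation.Binary.Sublist.Setoid.Properties as SublistProperties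
open import Data.List.Relation.Unary.Linked as Linked using (Linked; []; [-]; _∷_; linked?)
import Data.List.Relation.Unary.Linked.Properties as Linked
import Data.List.Relation.Unary.AllPairs.Properties as AllPairs
import Data.List.Relation.Unary.Sorted.TotalOrder.Properties as Sorted
import Data.List.Sort as Sort
open import Data.Maybe.Base as Maybe using (Maybe)
open import Data.Nat.Base using (ℕ; zero; suc; _+_; _∸_; _⊓_; _≤_; _<_; _>_; _≥_; z≤n; s≤s)
open import Data.Nat.Properties
open import Data.Product.Base using (∃; _×_; _,_; proj₁)
open import Function.Base using (_∘_; id)
open import Level using (0ℓ; _⊔_)
open import Relation.Binary.Bundles using (Setoid; DecTotalOrder)
import Relation.Binary.Construct.Flip.EqAndOrd as Flip
import Relation.Binary.Construct.On as On
open import Relation.Binary.PropositionalEquality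
  using (_≡_; refl; sym; trans; cong; cong₂; subst; setoid)
open import Relation.Nullary.Decidable using (Dec; yes; no; ¬?; dec⇒maybe)
open import Relation.Unary using (Pred; _⊆_)

infix 4 _≈_ _⊂_
infix 5 _⋆⟨_·_⟩_
infixl 9 _!_ _′

-- Trailing zeros are allowed in `parts`; the equality `_≈_` ignores them.
record Partition : Set where
  constructor mkPartition
  field
    parts         : List ℕ
    nonIncreasing : Linked _≥_ parts

open Partition public

at : List ℕ → ℕ → ℕ
at []       _       = 0
at (x ∷ xs) zero    = x
at (x ∷ xs) (suc i) = at xs i

-- Indices start at 0 throughout: α ! i is the part α_{i+1}.
_!_ : Partition → ℕ → ℕ
α ! i = at (parts α) i

_≈_ : Partition → Partition → Set
α ≈ β = ∀ i → α ! i ≡ β ! i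

partitionSetoid : Setoid 0ℓ 0ℓ
partitionSetoid = record
  { Carrier       = Partition
  ; _≈_           = _≈_
  ; isEquivalence = record
    { refl  = λ _ → refl
    ; sym   = λ p i → sym (p i)
    ; trans = λ p q i → trans (p i) (q i)
    }
  }

-- The number of positive parts.
ℓ : Partition → ℕ
ℓ α = length (filter (0 <?_) (parts α))

-- α as a sequence of prescribed length n (meaningful when ℓ α ≤ n).
seq : ℕ → Partition → List ℕ
seq n α = applyUpTo (α !_) n

Ferrers : Partition → Pred (ℕ × ℕ) 0ℓ
Ferrers α (i , j) = j < α ! i

_⊂_ : Partition → Partition → Set
α ⊂ β = Ferrers α ⊆ Ferrers β

replicate-≥ : ∀ n m → Linked _≥_ (replicate n m)
replicate-≥ zero          m = []
replicate-≥ (suc zero)    m = [-]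
replicate-≥ (suc (suc n)) m = ≤-refl ∷ replicate-≥ (suc n) m

at-mono : ∀ {xs} → Linked _≥_ xs → ∀ {i j} → i ≤ j → at xs j ≤ at xs i
at-mono []         _                     = z≤n
at-mono [-]        {j = zero}  z≤n       = ≤-refl
at-mono [-]        {j = suc j} _         = z≤n
at-mono (p ∷ ps) {zero}  {zero}  _       = ≤-refl
at-mono (p ∷ ps) {zero}  {suc j} _       = ≤-trans (at-mono ps {zero} {j} z≤n) p
at-mono (p ∷ ps) {suc i} {suc j} (s≤s q) = at-mono ps q

!-mono : ∀ α {i j} → i ≤ j → α ! j ≤ α ! i
!-mono α = at-mono (nonIncreasing α)

-- The partition (m, …, m) with n entries.
⟨_^_⟩ : ℕ → ℕ → Partition
⟨ m ^ n ⟩ = mkPartition (replicate n m) (replicate-≥ n m)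

count≥ : ℕ → List ℕ → ℕ
count≥ k xs = length (filter (k ≤?_) xs)

count≥-anti : ∀ xs {j k} → j ≤ k → count≥ k xs ≤ count≥ j xs
count≥-anti xs {j} {k} j≤k =
  length-mono-≤ (SublistProperties.filter⁺ (setoid ℕ) (k ≤?_) (j ≤?_) (λ { refl → ≤-trans j≤k }) (⊆-refl {x = xs}))

-- The parts of α ′ are the numbers #{i : α_i ≥ j} for j = 1, …, α_1.
_′ : Partition → Partition
α ′ = mkPartition (applyUpTo (λ j → count≥ (suc j) (parts α)) (α ! 0))
  (Linked.applyUpTo⁺₂ _ (α ! 0) (λ j → count≥-anti (parts α) (n≤1+n (suc j))))

-- (m - α_N, …, m - α_1); the truncated subtraction is exact when α ⊂ ⟨ m ^ N ⟩.
complement : ℕ → ℕ → Partition → Partition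
complement m N α = mkPartition (applyDownFrom (λ i → m ∸ α ! i) N)
  (Linked.applyDownFrom⁺₂ _ N (λ i → ∸-monoʳ-≤ m (!-mono α (n≤1+n i))))

-- An increasing sequence of elements of [N]; i : Fin N stands for the
-- element toℕ i + 1.
record Subsequence (N : ℕ) : Set where
  constructor mkSubsequence
  field
    elems      : List (Fin N)
    increasing : Linked Fin._<_ elems

open Subsequence public

subsequenceSetoid : ℕ → Setoid 0ℓ 0ℓ
subsequenceSetoid N = On.setoid (setoid (List (Fin N))) elems

len : ∀ {N} → Subsequence N → ℕ
len K = length (elems K)

-- α_k + N - k, where toℕ (opposite k) is N - (toℕ k + 1).
shifted : ∀ {N} → Partition → Fin N → ℕ
shifted α k = α ! toℕ k + toℕ (opposite k)

opposite-anti : ∀ {N} {i j : Fin N} → i Fin.< j → opposite j Fin.< opposite i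
opposite-anti {N} {i} {j} i<j
  rewrite opposite-prop i | opposite-prop j = ∸-monoʳ-< (s≤s i<j) (toℕ<n j)

shifted-anti : ∀ {N} α {i j : Fin N} → i Fin.< j → shifted α i > shifted α j
shifted-anti α i<j = +-mono-≤-< (!-mono α (<⇒≤ i<j)) (opposite-anti i<j)

-- Subtracts ρ_n from a sequence of length n.
unρ : List ℕ → List ℕ
unρ []       = []
unρ (x ∷ xs) = (x ∸ length xs) ∷ unρ xs

_+ρ : List ℕ → List ℕ
xs +ρ = zipWith _+_ xs (downFrom (length xs))

unρ-≥ : ∀ {xs} → Linked _>_ xs → Linked _≥_ (unρ xs)
unρ-≥ []                              = []
unρ-≥ [-]                             = [-]
unρ-≥ {x ∷ y ∷ ys} (s≤s y<x ∷ ps) = ∸-monoˡ-≤ (length ys) y<x ∷ unρ-≥ ps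

length-unρ : ∀ xs → length (unρ xs) ≡ length xs
length-unρ []       = refl
length-unρ (x ∷ xs) = cong suc (length-unρ xs)

head-large : ∀ {x xs} → Linked _>_ (x ∷ xs) → length xs ≤ x
head-large [-]      = z≤n
head-large (p ∷ ps) = ≤-trans (s≤s (head-large ps)) p

unρ-+ρ : ∀ {xs} → Linked _>_ xs → unρ xs +ρ ≡ xs
unρ-+ρ {[]}     _ = refl
unρ-+ρ {x ∷ xs} p = cong₂ _∷_
  (trans (cong (x ∸ length xs +_) (length-unρ xs)) (m∸n+n≡m (head-large p)))
  (unρ-+ρ (Linked.tail p))

shifted-> : ∀ {N} α (M : Subsequence N) → Linked _>_ (map (shifted α) (elems M))
shifted-> α M = Linked.map⁺ (Linked.map (shifted-anti α) (increasing M))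

-- The j-th part is α_{M_j} + N - M_j - (len M - j).
sub : ∀ N → Partition → Subsequence N → Partition
sub N α M = mkPartition (unρ (map (shifted α) (elems M))) (unρ-≥ (shifted-> α M))

-- No subtraction in `sub` is truncated: this is its defining equation.
sub-spec : ∀ N α (M : Subsequence N) →
           parts (sub N α M) +ρ ≡ map (shifted α) (elems M)
sub-spec N α M = unρ-+ρ (shifted-> α M)

-- For i = N - j + 1 in [N], j = N - i + 1, so i is in C N K exactly
-- when the opposite of i is not in K.
C : ∀ N → Subsequence N → Subsequence N
C N K = mkSubsequence
  (filter (λ i → ¬? (_∈?_ Fin._≟_ (opposite i) (elems K))) (allFin N))
  (Linked.filter⁺ _ Fin.<-trans (Linked.AllPairs⇒Linked (AllPairs.tabulate⁺-< id)))

-- seq n α + ρ_n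
seqρ : ℕ → Partition → List ℕ
seqρ n α = zipWith _+_ (seq n α) (downFrom n)

IsOverlap : ℕ → ℕ → Partition → Partition → Partition → Set
IsOverlap m n μ ν π =
  ℓ π ≤ m + n × seqρ (m + n) π ↭ seqρ m μ ++ seqρ n ν

≥-decTotalOrder : DecTotalOrder 0ℓ 0ℓ 0ℓ
≥-decTotalOrder = Flip.decTotalOrder ≤-decTotalOrder

module ≥-Sort = Sort ≥-decTotalOrder

at-applyUpTo : ∀ xs → applyUpTo (at xs) (length xs) ≡ xs
at-applyUpTo []       = refl
at-applyUpTo (x ∷ xs) = cong (x ∷_) (at-applyUpTo xs)

zipρ-> : ∀ f n → (∀ i → f (suc i) ≤ f i) →
         Linked _>_ (zipWith _+_ (applyUpTo f n) (downFrom n))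
zipρ-> f zero          _ = []
zipρ-> f (suc zero)    _ = [-]
zipρ-> f (suc (suc n)) p = +-mono-≤-< (p 0) ≤-refl ∷ zipρ-> (f ∘ suc) (suc n) (p ∘ suc)

seqρ-> : ∀ n α → Linked _>_ (seqρ n α)
seqρ-> n α = zipρ-> (α !_) n (λ i → !-mono α (n≤1+n i))

length-seqρ : ∀ n α → length (seqρ n α) ≡ n
length-seqρ n α = trans (length-zipWith _+_ (seq n α) (downFrom n))
  (trans (cong₂ _⊓_ (length-applyUpTo (α !_) n) (length-downFrom n)) (⊓-idem n))

isOverlap? : ∀ m n μ ν → Dec (∃ (IsOverlap m n μ ν))
isOverlap? m n μ ν with linked? _>?_ (≥-Sort.sort (seqρ m μ ++ seqρ n ν))
... | yes s> = yes (π , ≤-trans (length-filter (0 <?_) (parts π)) (≤-reflexive length-π)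
                      , ↭-trans (↭-reflexive seqρ-π) (≥-Sort.sort-↭ xs))
  where
  xs = seqρ m μ ++ seqρ n ν
  s  = ≥-Sort.sort xs
  π  = mkPartition (unρ s) (unρ-≥ s>)
  length-π : length (parts π) ≡ m + n
  length-π = trans (length-unρ s) (trans (↭-length (≥-Sort.sort-↭ xs))
    (trans (length-++ (seqρ m μ)) (cong₂ _+_ (length-seqρ m μ) (length-seqρ n ν))))
  seqρ-π : seqρ (m + n) π ≡ s
  seqρ-π = trans (cong (λ k → seqρ k π) (sym length-π))
    (trans (cong (λ ys → zipWith _+_ ys (downFrom (length (parts π)))) (at-applyUpTo (parts π)))
      (unρ-+ρ s>))
... | no ¬s> = no λ (π , _ , π↭xs) → ¬s> (subst (Linked _>_)
    (Pointwise-≡⇒≡ (Sorted.↗↭↗⇒≋ (DecTotalOrder.totalOrder ≥-decTotalOrder)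
      (Linked.map <⇒≤ (seqρ-> (m + n) π))
      (≥-Sort.sort-↗ xs)
      (↭⇒↭ₛ (↭-trans π↭xs (↭-sym (≥-Sort.sort-↭ xs))))))
    (seqρ-> (m + n) π))
  where
  xs = seqρ m μ ++ seqρ n ν

-- The (m,n)-overlap of μ and ν (meaningful when ℓ μ ≤ m and ℓ ν ≤ n);
-- `nothing` is the symbol ∞. A π with IsOverlap m n μ ν π is unique up to
-- _≈_, as seqρ (m + n) π is strictly decreasing.
_⋆⟨_·_⟩_ : Partition → ℕ → ℕ → Partition → Maybe Partition
μ ⋆⟨ m · n ⟩ ν = Maybe.map proj₁ (dec⇒maybe (isOverlap? m n μ ν))

infix 3 _restrictedTo_

-- The subset of S cut out by P, with the equality of S.
_restrictedTo_ : ∀ {a e p} (S : Setoid a e) → Pred (Setoid.Carrier S) p → Setoid (a ⊔ p) e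
S restrictedTo P = On.setoid {B = ∃ P} S proj₁

{-# OPTIONS --safe #-}
module Submission where

-- Read every partition as its set of shifted parts λ_i + N - i. For λ ⊂ ⟨m^N⟩
-- the set of λ and the reflection x ↦ m + N - 1 - x of the set of λ′ partition
-- {0, …, m + N - 1}: they are disjoint because i ≤ λ′_j iff j ≤ λ_i, and their
-- sizes add up to m + N. Passing to the complement of λ also reflects its set.
-- Hence, with N = n + l, reflecting κ′, λ′ and sub(λ̃, C(K)) turns the overlap
-- equation into: the set of κ is contained in that of λ, and what remains of
-- the latter is the reflected set of ν. Given (μ, ν), the inverse therefore
-- takes λ = μ′ and lets K mark the elements of λ that lie in the set of κ; the
-- second component is then ν, because cancelling the set of μ leaves it as the
-- only possibility.

open import Defs
open import Data.Nat.Base using (ℕ; _+_; _≤_)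
open import Data.Maybe.Base using (just)
open import Data.Maybe.Relation.Binary.Pointwise using (Pointwise)
open import Data.Product.Base using (Σ-syntax; _×_; _,_; proj₁)
open import Data.Product.Relation.Binary.Pointwise.NonDependent using (_×ₛ_)
open import Function.Bundles using (Bijection)
open import Relation.Binary.Bundles using (Setoid)
open import Relation.Binary.PropositionalEquality using (_≡_)

open import Data.Fin.Base as Fin using (Fin; toℕ; opposite)
open import Data.Fin.Properties as Fin
  using (toℕ<n; toℕ-fromℕ; toℕ-inject₁; opposite-involutive)
open import Data.List.Base
  using (List; []; _∷_; _++_; map; length; filter; replicate; zipWith; applyUpTo; applyDownFrom; downFrom; allFin; tabulate)
open import Data.List.Properties
  using (length-++; length-map; length-downFrom; length-tabulate; map-cong; map-injective;
         map-tabulate; filter-accept; filter-reject; ∷-injective; ++-identityʳ; length-filter)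
open import Data.List.Membership.DecPropositional using (_∈?_)
open import Data.List.Membership.Propositional using (_∈_; _∉_)
open import Data.List.Membership.Propositional.Properties
  using (∈-map⁺; ∈-map⁻; ∈-++⁺ˡ; ∈-++⁺ʳ; ∈-++⁻; ∈-filter⁺; ∈-filter⁻; ∈-allFin; ∈-downFrom⁺; ∈-∃++)
open import Data.List.Relation.Binary.Permutation.Propositional
  using (_↭_; prep; ↭-refl; ↭-sym; ↭-trans; ↭-reflexive; ↭⇒↭ₛ)
open import Data.List.Relation.Binary.Permutation.Propositional.Properties
  using (↭-length; ∈-resp-↭; shift; drop-∷)
open import Data.List.Relation.Binary.Pointwise using (Pointwise-≡⇒≡)
open import Data.List.Relation.Binary.Subset.Propositional using (_⊆_)
open import Data.List.Relation.Unary.All as All using (All; []; _∷_)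
open import Data.List.Relation.Unary.AllPairs as AllPairs using ([]; _∷_)
open import Data.List.Relation.Unary.Any using (here; there)
open import Data.List.Relation.Unary.Linked as Linked using (Linked; []; [-]; _∷_)
import Data.List.Relation.Unary.Linked.Properties as Linked
import Data.List.Relation.Unary.AllPairs.Properties as AllPairs
import Data.List.Relation.Unary.Sorted.TotalOrder.Properties as Sorted
open import Data.List.Relation.Unary.Unique.Propositional using (Unique)
import Data.List.Relation.Unary.Unique.Propositional.Properties as Unique
open import Data.Nat.Base using (zero; suc; _∸_; _<_; _>_; _≥_; z≤n; s≤s; s≤s⁻¹)
open import Data.Nat.Properties
open import Data.Maybe.Relation.Binary.Pointwise using (just)
open import Data.Nat.Solver using (module +-*-Solver)
open import Data.Empty using (⊥)
open import Data.Product.Base using (∃; ∃-syntax; proj₂)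
open import Data.Sum.Base using (_⊎_; inj₁; inj₂)
open import Function.Base using (_∘_; id)
open import Relation.Binary.Bundles using (DecTotalOrder)
open import Relation.Binary.Definitions using (tri<; tri≈; tri>)
open import Relation.Binary.PropositionalEquality
  using (_≢_; refl; sym; trans; cong; cong₂; subst)
open import Relation.Nullary.Decidable using (Dec; yes; no)
open import Relation.Nullary.Negation using (contradiction)

-- Lists without repetition, compared as sets.

∈-tail : ∀ {A : Set} {x y : A} {xs} → x ≢ y → y ∈ x ∷ xs → y ∈ xs
∈-tail x≢y (here refl) = contradiction refl x≢y
∈-tail _   (there y∈)  = y∈

-- Induction on `xs`: its head `x` is moved to the front of `ys`, and since `x` does not recur in
-- `xs`, the inclusion of the remaining entries survives its removal.
unique-⊆⇒↭-++ : ∀ {A : Set} {xs ys : List A} → Unique xs → xs ⊆ ys → ∃[ zs ] ys ↭ xs ++ zs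
unique-⊆⇒↭-++ {xs = []}     {ys} _            _  = ys , ↭-refl
unique-⊆⇒↭-++ {xs = x ∷ xs} (x∉xs ∷ xs!) xs⊆ys
  with as , bs , refl ← ∈-∃++ (xs⊆ys (here refl))
  with zs , p ← unique-⊆⇒↭-++ xs! (λ y∈xs →
         ∈-tail (All.lookup x∉xs y∈xs) (∈-resp-↭ (shift x as bs) (xs⊆ys (there y∈xs))))
  = zs , ↭-trans (shift x as bs) (prep x p)

unique-⊆⇒length-≤ : ∀ {A : Set} {xs ys : List A} → Unique xs → xs ⊆ ys → length xs ≤ length ys
unique-⊆⇒length-≤ {xs = xs} xs! xs⊆ys with zs , p ← unique-⊆⇒↭-++ xs! xs⊆ys =
  ≤-trans (m≤m+n (length xs) (length zs)) (≤-reflexive (sym (trans (↭-length p) (length-++ xs))))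

-- Counting leaves no room for extra entries. One inclusion and a count thus give a permutation, and
-- `ys` turns out free of repetitions without a separate argument.
unique-⊆-length⇒↭ : ∀ {A : Set} {xs ys : List A} →
                    Unique xs → xs ⊆ ys → length ys ≤ length xs → ys ↭ xs
unique-⊆-length⇒↭ {xs = xs} xs! xs⊆ys ∣ys∣≤∣xs∣ with unique-⊆⇒↭-++ xs! xs⊆ys
... | []     , p = ↭-trans p (↭-reflexive (++-identityʳ xs))
... | z ∷ zs , p = contradiction
  (≤-trans (≤-reflexive (sym (trans (↭-length p) (length-++ xs)))) ∣ys∣≤∣xs∣)
  (m+1+n≰m (length xs))

unique-set⇒↭ : ∀ {A : Set} {xs ys : List A} → Unique xs → Unique ys → xs ⊆ ys → ys ⊆ xs → ys ↭ xs
unique-set⇒↭ xs! ys! xs⊆ys ys⊆xs = unique-⊆-length⇒↭ xs! xs⊆ys (unique-⊆⇒length-≤ ys! ys⊆xs)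

++-cancelˡ-↭ : ∀ {A : Set} (xs : List A) {ys zs} → xs ++ ys ↭ xs ++ zs → ys ↭ zs
++-cancelˡ-↭ []       p = p
++-cancelˡ-↭ (x ∷ xs) p = ++-cancelˡ-↭ xs (drop-∷ p)

linked->⇒unique : ∀ {xs} → Linked _>_ xs → Unique xs
linked->⇒unique = AllPairs.map >⇒≢ ∘ Linked.Linked⇒AllPairs (λ p q → <-trans q p)

-- Both lists are sorted for `≥`, and sorting has a unique result. This brings the permutations in
-- the definition of overlap back to equality of sequences.
↭⇒≡ : ∀ {xs ys} → Linked _>_ xs → Linked _>_ ys → xs ↭ ys → xs ≡ ys
↭⇒≡ xs> ys> p = Pointwise-≡⇒≡ (Sorted.↗↭↗⇒≋ (DecTotalOrder.totalOrder ≥-decTotalOrder)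
  (Linked.map <⇒≤ xs>) (Linked.map <⇒≤ ys>) (↭⇒↭ₛ p))

-- Reflection in an interval, and entries of lists.

flip-> : ∀ {T xs} → Linked _>_ xs → All (_< T) xs → Linked _<_ (map (λ x → T ∸ suc x) xs)
flip-> []       _              = []
flip-> [-]      _              = [-]
flip-> (p ∷ ps) (x<T ∷ xs<T) = ∸-monoʳ-< (s≤s p) x<T ∷ flip-> ps xs<T

suc-flip : ∀ {T x} → x < T → suc (x + (T ∸ suc x)) ≡ T
suc-flip x<T = m+[n∸m]≡n x<T

-- A row of a diagram is determined by its cells; equalities between parts of conjugates are reduced
-- to cells in this way.
<⇔⇒≡ : ∀ {a b} → (∀ {i} → i < a → i < b) → (∀ {i} → i < b → i < a) → a ≡ b
<⇔⇒≡ {a} {b} f g with <-cmp a b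
... | tri< a<b _ _ = contradiction (g a<b) (<-irrefl refl)
... | tri≈ _ a≡b _ = a≡b
... | tri> _ _ b<a = contradiction (f b<a) (<-irrefl refl)

at-applyUpTo-< : ∀ f {n i} → i < n → at (applyUpTo f n) i ≡ f i
at-applyUpTo-< f {suc n} {zero}  _       = refl
at-applyUpTo-< f {suc n} {suc i} (s≤s p) = at-applyUpTo-< (f ∘ suc) p

at-applyUpTo-≥ : ∀ f {n i} → n ≤ i → at (applyUpTo f n) i ≡ 0
at-applyUpTo-≥ f z≤n     = refl
at-applyUpTo-≥ f (s≤s p) = at-applyUpTo-≥ (f ∘ suc) p

at-applyDownFrom : ∀ f {n} (k : Fin n) → at (applyDownFrom f n) (toℕ k) ≡ f (toℕ (opposite k))
at-applyDownFrom f {suc n} Fin.zero    = cong f (sym (toℕ-fromℕ n))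
at-applyDownFrom f {suc n} (Fin.suc k) =
  trans (at-applyDownFrom f k) (cong f (sym (toℕ-inject₁ (opposite k))))

applyDownFrom-cong : ∀ {f g : ℕ → ℕ} → (∀ i → f i ≡ g i) → ∀ n → applyDownFrom f n ≡ applyDownFrom g n
applyDownFrom-cong f≗g zero    = refl
applyDownFrom-cong f≗g (suc n) = cong₂ _∷_ (f≗g n) (applyDownFrom-cong f≗g n)

at-replicate-≤ : ∀ n m i → at (replicate n m) i ≤ m
at-replicate-≤ zero    m i       = z≤n
at-replicate-≤ (suc n) m zero    = ≤-refl
at-replicate-≤ (suc n) m (suc i) = at-replicate-≤ n m i

at-replicate-≥ : ∀ n m {i} → n ≤ i → at (replicate n m) i ≡ 0
at-replicate-≥ zero    m _       = refl
at-replicate-≥ (suc n) m (s≤s p) = at-replicate-≥ n m p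

at-replicate-< : ∀ n m {i} → i < n → at (replicate n m) i ≡ m
at-replicate-< (suc n) m {zero}  _       = refl
at-replicate-< (suc n) m {suc i} (s≤s p) = at-replicate-< n m p

-- Conjugates, lengths and bounding rectangles.

at-count : ∀ {xs k i} → Linked _≥_ xs → 0 < k → i < count≥ k xs → k ≤ at xs i
at-count {x ∷ xs} {k} {i} xs≥ 0<k i< with k ≤? x
at-count {x ∷ xs} {k} {zero}  xs≥ 0<k i<         | yes k≤x = k≤x
at-count {x ∷ xs} {k} {suc i} xs≥ 0<k i<         | yes k≤x =
  at-count (Linked.tail xs≥) 0<k (s≤s⁻¹ (subst (suc i <_) (cong length (filter-accept (k ≤?_) k≤x)) i<))
-- The head is the largest entry, so once it is below `k` no later entry can be counted.
... | no k≰x = contradiction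
  (≤-trans (at-count (Linked.tail xs≥) 0<k (subst (i <_) (cong length (filter-reject (k ≤?_) k≰x)) i<))
    (at-mono xs≥ {0} {suc i} z≤n)) k≰x

-- Everything before index `i` is at least as large, so it is counted too. Positivity of `k` keeps
-- `i` inside the list, because `at` is 0 past the end.
count-at : ∀ {xs k i} → Linked _≥_ xs → 0 < k → k ≤ at xs i → i < count≥ k xs
count-at {[]} xs≥ 0<k k≤ = contradiction (<-≤-trans 0<k k≤) λ ()
count-at {x ∷ xs} {k} {i} xs≥ 0<k k≤
  rewrite filter-accept (k ≤?_) {xs = xs} (≤-trans k≤ (at-mono xs≥ {0} {i} z≤n)) with i
... | zero  = s≤s z≤n
... | suc i = s≤s (count-at (Linked.tail xs≥) 0<k k≤)

-- α′_j counts the parts ≥ j also beyond the last listed part of α ′.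
′-! : ∀ α j → α ′ ! j ≡ count≥ (suc j) (parts α)
′-! α j with j <? α ! 0
... | yes j<α₀ = at-applyUpTo-< _ j<α₀
... | no  j≮α₀ = trans (at-applyUpTo-≥ _ (≮⇒≥ j≮α₀)) (sym (n≤0⇒n≡0 (≮⇒≥ λ 0<c →
  j≮α₀ (at-count (nonIncreasing α) (s≤s z≤n) 0<c))))

-- Conjugation reflects the diagram in its diagonal. From here on the definition of `_′` is accessed
-- only through this and `′⇐`.
′⇒ : ∀ α {i j} → i < α ′ ! j → j < α ! i
′⇒ α {i} {j} p = at-count (nonIncreasing α) (s≤s z≤n) (subst (i <_) (′-! α j) p)

′⇐ : ∀ α {i j} → j < α ! i → i < α ′ ! j
′⇐ α {i} {j} p = subst (i <_) (sym (′-! α j)) (count-at (nonIncreasing α) (s≤s z≤n) p)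

′-cong : ∀ {α β} → α ≈ β → α ′ ≈ β ′
′-cong {α} {β} α≈β j = <⇔⇒≡
  (λ {i} p → ′⇐ β (subst (j <_) (α≈β i) (′⇒ α p)))
  (λ {i} p → ′⇐ α (subst (j <_) (sym (α≈β i)) (′⇒ β p)))

′-involutive : ∀ α → α ′ ′ ≈ α
′-involutive α j = <⇔⇒≡ (′⇒ α ∘ ′⇒ (α ′)) (′⇐ (α ′) ∘ ′⇐ α)

′-injective : ∀ {α β} → α ′ ≈ β ′ → α ≈ β
′-injective {α} {β} p i =
  trans (sym (′-involutive α i)) (trans (′-cong {α ′} {β ′} p i) (′-involutive β i))

<ℓ⇒ : ∀ α {i} → i < ℓ α → 0 < α ! i
<ℓ⇒ α = at-count (nonIncreasing α) (s≤s z≤n)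

<ℓ⇐ : ∀ α {i} → 0 < α ! i → i < ℓ α
<ℓ⇐ α = count-at (nonIncreasing α) (s≤s z≤n)

ℓ≤⇒!≡0 : ∀ α {i} → ℓ α ≤ i → α ! i ≡ 0
ℓ≤⇒!≡0 α p = n≤0⇒n≡0 (≮⇒≥ λ 0<αᵢ → <⇒≱ (<ℓ⇐ α 0<αᵢ) p)

!≡0⇒ℓ≤ : ∀ α {i} → α ! i ≡ 0 → ℓ α ≤ i
!≡0⇒ℓ≤ α p = ≮⇒≥ λ i<ℓ → <⇒≢ (<ℓ⇒ α i<ℓ) (sym p)

ℓ′≤ : ∀ α {m} → α ! 0 ≤ m → ℓ (α ′) ≤ m
ℓ′≤ α p = !≡0⇒ℓ≤ (α ′) (n≤0⇒n≡0 (≮⇒≥ λ q → <⇒≱ (′⇒ α q) p))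

′≤ : ∀ α {n} → ℓ α ≤ n → ∀ j → α ′ ! j ≤ n
′≤ α p j = ≮⇒≥ λ n<α′ → <⇒≱ (<ℓ⇐ α (≤-<-trans z≤n (′⇒ α n<α′))) p

⊂⇒!≤ : ∀ {α m n} → α ⊂ ⟨ m ^ n ⟩ → ∀ i → α ! i ≤ m
⊂⇒!≤ {m = m} {n} α⊂ i = ≮⇒≥ λ m<αᵢ → <⇒≱ (α⊂ {i , m} m<αᵢ) (at-replicate-≤ n m i)

⊂⇒ℓ≤ : ∀ {α m n} → α ⊂ ⟨ m ^ n ⟩ → ℓ α ≤ n
⊂⇒ℓ≤ {α} {m} {n} α⊂ = ≮⇒≥ λ n<ℓ →
  contradiction (α⊂ {n , 0} (<ℓ⇒ α n<ℓ)) (<-irrefl (sym (at-replicate-≥ n m ≤-refl)))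

⊂-intro : ∀ {α m n} → (∀ i → α ! i ≤ m) → ℓ α ≤ n → α ⊂ ⟨ m ^ n ⟩
⊂-intro {α} {m} {n} α≤ ℓ≤ {i , j} j<αᵢ = subst (j <_) (sym (at-replicate-< n m i<n)) (<-≤-trans j<αᵢ (α≤ i))
  where
  i<n : i < n
  i<n = <-≤-trans (<ℓ⇐ α (≤-<-trans z≤n j<αᵢ)) ℓ≤

-- Sequences of shifted parts.

suc-opposite : ∀ {n} (i : Fin n) → suc (toℕ i + toℕ (opposite i)) ≡ n
suc-opposite {suc n} Fin.zero    = cong suc (toℕ-fromℕ n)
suc-opposite {suc n} (Fin.suc i) =
  cong suc (trans (cong (λ k → suc (toℕ i + k)) (toℕ-inject₁ (opposite i))) (suc-opposite i))

zipρ-shifted : ∀ f n → zipWith _+_ (applyUpTo f n) (downFrom n)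
                       ≡ tabulate (λ (k : Fin n) → f (toℕ k) + toℕ (opposite k))
zipρ-shifted f zero    = refl
zipρ-shifted f (suc n) = cong₂ _∷_ (cong (f 0 +_) (sym (toℕ-fromℕ n)))
  (trans (zipρ-shifted (f ∘ suc) n) (tab-cong λ k → cong (f (suc (toℕ k)) +_) (sym (toℕ-inject₁ (opposite k)))))
  where
  tab-cong : ∀ {n} {g h : Fin n → ℕ} → (∀ k → g k ≡ h k) → tabulate g ≡ tabulate h
  tab-cong {zero}  _ = refl
  tab-cong {suc n} p = cong₂ _∷_ (p Fin.zero) (tab-cong (p ∘ Fin.suc))

-- Puts the full sequence on the same footing as a subsequence in `sub`: both are images of index
-- lists under `shifted α`.
seqρ-shifted : ∀ n α → seqρ n α ≡ map (shifted α) (allFin n)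
seqρ-shifted n α = trans (zipρ-shifted (α !_) n) (sym (map-tabulate id (shifted α)))

∈-seqρ⁻ : ∀ {n} α {x} → x ∈ seqρ n α → ∃[ i ] x ≡ shifted {n} α i
∈-seqρ⁻ {n} α {x} x∈ with i , _ , p ← ∈-map⁻ (shifted α) (subst (x ∈_) (seqρ-shifted n α) x∈) = i , p

seqρ-parts : ∀ {n} α → length (parts α) ≡ n → seqρ n α ≡ parts α +ρ
seqρ-parts α refl = cong (λ xs → zipWith _+_ xs (downFrom (length (parts α)))) (at-applyUpTo (parts α))

zipρ-cong : ∀ {f g : ℕ → ℕ} → (∀ i → f i ≡ g i) → ∀ n →
            zipWith _+_ (applyUpTo f n) (downFrom n) ≡ zipWith _+_ (applyUpTo g n) (downFrom n)
zipρ-cong p zero    = refl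
zipρ-cong p (suc n) = cong₂ _∷_ (cong (_+ n) (p 0)) (zipρ-cong (p ∘ suc) n)

seqρ-cong : ∀ n {α β} → α ≈ β → seqρ n α ≡ seqρ n β
seqρ-cong n α≈β = zipρ-cong α≈β n

zipρ-injective : ∀ f g n → zipWith _+_ (applyUpTo f n) (downFrom n) ≡ zipWith _+_ (applyUpTo g n) (downFrom n) →
                 ∀ {i} → i < n → f i ≡ g i
zipρ-injective f g (suc n) p {zero}  _       = +-cancelʳ-≡ n (f 0) (g 0) (proj₁ (∷-injective p))
zipρ-injective f g (suc n) p {suc i} (s≤s q) = zipρ-injective (f ∘ suc) (g ∘ suc) n (proj₂ (∷-injective p)) q

-- Below `n` the staircase cancels; from `n` on the length bounds force both parts to be 0.
seqρ-injective : ∀ {n α β} → ℓ α ≤ n → ℓ β ≤ n → seqρ n α ≡ seqρ n β → α ≈ β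
seqρ-injective {n} {α} {β} ℓα ℓβ p i with i <? n
... | yes i<n = zipρ-injective (α !_) (β !_) n p i<n
... | no  i≮n = trans (ℓ≤⇒!≡0 α (≤-trans ℓα (≮⇒≥ i≮n))) (sym (ℓ≤⇒!≡0 β (≤-trans ℓβ (≮⇒≥ i≮n))))

shifted-injective : ∀ {n} α {i j : Fin n} → shifted α i ≡ shifted α j → i ≡ j
shifted-injective α {i} {j} p with Fin.<-cmp i j
... | tri< i<j _ _ = contradiction (sym p) (<⇒≢ (shifted-anti α i<j))
... | tri≈ _ i≡j _ = i≡j
... | tri> _ _ j<i = contradiction p (<⇒≢ (shifted-anti α j<i))

-- Bounds on shifted parts, and duality with the conjugate.

opposite<n : ∀ {n} (i : Fin n) → toℕ (opposite i) < n
opposite<n i = toℕ<n (opposite i)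

seqρ-bound : ∀ {n m} α → (∀ i → α ! i ≤ m) → ∀ {x} → x ∈ seqρ n α → x < m + n
seqρ-bound α α≤m x∈ with i , refl ← ∈-seqρ⁻ α x∈ = +-mono-≤-< (α≤m (toℕ i)) (opposite<n i)

-- Here `p` and `q` stand for the opposites of `i` and `j`, so that by `suc-opposite` the right-hand
-- side of the hypothesis is the sum of the two side lengths.
cancel-opposites : ∀ a b i j {p q} → suc ((a + p) + (b + q)) ≡ suc (j + q) + suc (i + p) → a + b ≡ suc (i + j)
cancel-opposites a b i j {p} {q} eq = +-cancelʳ-≡ (suc (p + q)) (a + b) (suc (i + j))
  (trans
    (solve 4 (λ a b p q → (a :+ b) :+ (con 1 :+ (p :+ q)) := con 1 :+ ((a :+ p) :+ (b :+ q))) refl a b p q)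
    (trans eq
      (solve 4 (λ i j p q → (con 1 :+ (j :+ q)) :+ (con 1 :+ (i :+ p)) := (con 1 :+ (i :+ j)) :+ (con 1 :+ (p :+ q)))
        refl i j p q)))
  where open +-*-Solver

-- With α_i + α′_j = i + j + 1 (0-based), neither j < α_i, i.e. i < α′_j, nor its negation is possible.
dual-disjoint : ∀ α {n m a b} → a ∈ seqρ n α → b ∈ seqρ m (α ′) → suc (a + b) ≢ m + n
dual-disjoint α {n} {m} a∈ b∈ eq with ∈-seqρ⁻ {n} α a∈ | ∈-seqρ⁻ {m} (α ′) b∈
... | i , refl | j , refl = go (toℕ j <? α ! toℕ i)
  where
  sum : α ! toℕ i + α ′ ! toℕ j ≡ suc (toℕ i + toℕ j)
  sum = cancel-opposites (α ! toℕ i) (α ′ ! toℕ j) (toℕ i) (toℕ j)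
    (trans eq (sym (cong₂ _+_ (suc-opposite j) (suc-opposite i))))
  go : Dec (toℕ j < α ! toℕ i) → ⊥
  go (yes j<αᵢ) = <⇒≱ {suc (toℕ i + toℕ j)}
    (≤-trans (≤-reflexive (cong suc (+-comm (suc (toℕ i)) (toℕ j)))) (+-mono-≤ j<αᵢ (′⇐ α j<αᵢ)))
    (≤-reflexive sum)
  go (no j≮αᵢ) = <⇒≱ {toℕ i + toℕ j} (≤-reflexive (sym sum))
    (≤-trans (+-mono-≤ (≮⇒≥ j≮αᵢ) (≮⇒≥ (j≮αᵢ ∘ ′⇒ α))) (≤-reflexive (+-comm (toℕ j) (toℕ i))))

-- Here the set of `α` is the one that is reflected. Both lists lie in the interval, `dual-disjoint`
-- keeps them apart, and their lengths `m` and `n` exhaust it.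
dual-↭ : ∀ α {n m} → α ⊂ ⟨ m ^ n ⟩ →
         downFrom (m + n) ↭ seqρ m (α ′) ++ map (λ a → m + n ∸ suc a) (seqρ n α)
dual-↭ α {n} {m} α⊂ =
  unique-⊆-length⇒↭ (Unique.++⁺ (linked->⇒unique (seqρ-> m (α ′))) flips! disjoint) ⊆-all
    (≤-reflexive (trans (length-downFrom (m + n)) (sym lengths)))
  where
  flip : ℕ → ℕ
  flip x = m + n ∸ suc x
  as<T : ∀ {a} → a ∈ seqρ n α → a < m + n
  as<T = seqρ-bound α (⊂⇒!≤ {α} {m} {n} α⊂)
  bs<T : ∀ {b} → b ∈ seqρ m (α ′) → b < m + n
  bs<T {b} b∈ = subst (b <_) (+-comm n m) (seqρ-bound (α ′) (′≤ α (⊂⇒ℓ≤ {α} {m} {n} α⊂)) b∈)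
  flips! : Unique (map flip (seqρ n α))
  flips! = AllPairs.map <⇒≢ (Linked.Linked⇒AllPairs <-trans (flip-> (seqρ-> n α) (All.tabulate as<T)))
  disjoint : ∀ {x} → (x ∈ seqρ m (α ′)) × (x ∈ map flip (seqρ n α)) → ⊥
  disjoint (x∈ , x∈flips) with a , a∈ , refl ← ∈-map⁻ flip x∈flips =
    dual-disjoint α a∈ x∈ (suc-flip (as<T a∈))
  ⊆-all : seqρ m (α ′) ++ map flip (seqρ n α) ⊆ downFrom (m + n)
  ⊆-all x∈ with ∈-++⁻ (seqρ m (α ′)) x∈
  ... | inj₁ x∈bs = ∈-downFrom⁺ (bs<T x∈bs)
  ... | inj₂ x∈flips with a , a∈ , refl ← ∈-map⁻ flip x∈flips =
    ∈-downFrom⁺ (≤-trans (s≤s (m≤n+m (flip a) a)) (≤-reflexive (suc-flip (as<T a∈))))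
  lengths : length (seqρ m (α ′) ++ map flip (seqρ n α)) ≡ m + n
  lengths = trans (length-++ (seqρ m (α ′)))
    (cong₂ _+_ (length-seqρ m (α ′)) (trans (length-map flip (seqρ n α)) (length-seqρ n α)))

-- The covering half of `dual-↭`, with the reflection written as an equation between sums, so that
-- partners can be compared by cancellation.
dual-cover : ∀ α {n m} → α ⊂ ⟨ m ^ n ⟩ → ∀ {b} → b < m + n →
             b ∈ seqρ m (α ′) ⊎ (∃[ a ] a ∈ seqρ n α × suc (a + b) ≡ m + n)
dual-cover α {n} {m} α⊂ b<T
  with ∈-++⁻ (seqρ m (α ′)) (∈-resp-↭ (dual-↭ α {n} {m} α⊂) (∈-downFrom⁺ b<T))
... | inj₁ b∈ = inj₁ b∈
... | inj₂ b∈flips with a , a∈ , refl ← ∈-map⁻ _ b∈flips =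
  inj₂ (a , a∈ , suc-flip (seqρ-bound α (⊂⇒!≤ {α} {m} {n} α⊂) a∈))

suc-cancel : ∀ {a a′ b T} → suc (a + b) ≡ T → suc (a′ + b) ≡ T → a ≡ a′
suc-cancel {a} {a′} {b} p q = +-cancelʳ-≡ b a a′ (suc-injective (trans p (sym q)))

-- Overlaps as permutations of shifted parts.

overlap⇒⋆ : ∀ {m n μ ν π} → IsOverlap m n μ ν π → Pointwise _≈_ (μ ⋆⟨ m · n ⟩ ν) (just π)
overlap⇒⋆ {m} {n} {μ} {ν} {π} (ℓπ , p) with isOverlap? m n μ ν
-- The witness `π′` found by the decision procedure may differ from `π` in trailing zeros; both have
-- the same decreasing shifted sequence.
... | yes (π′ , ℓπ′ , q) = just (seqρ-injective {m + n} {π′} {π} ℓπ′ ℓπ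
        (↭⇒≡ (seqρ-> (m + n) π′) (seqρ-> (m + n) π) (↭-trans q (↭-sym p))))
... | no ∄ = contradiction (π , ℓπ , p) ∄

⋆⇒↭ : ∀ {m n μ ν π} → Pointwise _≈_ (μ ⋆⟨ m · n ⟩ ν) (just π) → seqρ (m + n) π ↭ seqρ m μ ++ seqρ n ν
⋆⇒↭ {m} {n} {μ} {ν} {π} p with isOverlap? m n μ ν
⋆⇒↭ {m} {n} {μ} {ν} {π} (just π′≈π) | yes (π′ , _ , q) =
  subst (_↭ seqρ m μ ++ seqρ n ν) (seqρ-cong (m + n) {π′} {π} π′≈π) q

-- Subpartitions, complements and selection of shifted parts.

length-sub : ∀ {N} α (M : Subsequence N) → length (parts (sub N α M)) ≡ len M
length-sub α M = trans (length-unρ (map (shifted α) (elems M))) (length-map (shifted α) (elems M))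

ℓ-sub : ∀ {N} α (M : Subsequence N) → ℓ (sub N α M) ≤ len M
ℓ-sub α M = ≤-trans (length-filter (0 <?_) (parts (sub _ α M))) (≤-reflexive (length-sub α M))

-- With `len M` as the prescribed length there is neither padding nor cutting, so `sub-spec`
-- applies.
seqρ-sub : ∀ {N k} α (M : Subsequence N) → len M ≡ k → seqρ k (sub N α M) ≡ map (shifted α) (elems M)
seqρ-sub α M refl = trans (seqρ-parts (sub _ α M) (length-sub α M)) (sub-spec _ α M)

sub-cong : ∀ {N} α β {M M₂ : Subsequence N} → α ≈ β → elems M ≡ elems M₂ → sub N α M ≈ sub N β M₂
sub-cong α β {M} α≈β refl i = cong (λ xs → at (unρ xs) i)
  (map-cong (λ k → cong (_+ toℕ (opposite k)) (α≈β (toℕ k))) (elems M))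

C-cong : ∀ {N} {K K₂ : Subsequence N} → elems K ≡ elems K₂ → elems (C N K) ≡ elems (C N K₂)
C-cong refl = refl

complement-cong : ∀ m N {α β} → α ≈ β → complement m N α ≈ complement m N β
complement-cong m N α≈β i = cong (λ xs → at xs i) (applyDownFrom-cong (λ j → cong (m ∸_) (α≈β j)) N)

∈-C⁺ : ∀ {N} (K : Subsequence N) {i} → i ∉ elems K → opposite i ∈ elems (C N K)
∈-C⁺ K {i} i∉K = ∈-filter⁺ _ (∈-allFin (opposite i))
  (i∉K ∘ subst (_∈ elems K) (opposite-involutive i))

∈-C⁻ : ∀ {N} (K : Subsequence N) {i} → i ∈ elems (C N K) → opposite i ∉ elems K
∈-C⁻ {N} K i∈ = proj₂ (∈-filter⁻ _ {xs = allFin N} i∈)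

elems-unique : ∀ {N} (K : Subsequence N) → Unique (elems K)
elems-unique K = AllPairs.map Fin.<⇒≢ (Linked.Linked⇒AllPairs Fin.<-trans (increasing K))

-- Up to `opposite`, `C N K` is the set complement of `K`, so the two lists together are a
-- rearrangement of `allFin N`.
len-C : ∀ {N} (K : Subsequence N) → len (C N K) + len K ≡ N
len-C {N} K = trans (sym lengths) (trans (↭-length all↭) (length-tabulate id))
  where
  opposite-injective : ∀ {i j : Fin N} → opposite i ≡ opposite j → i ≡ j
  opposite-injective {i} {j} p =
    trans (sym (opposite-involutive i)) (trans (cong opposite p) (opposite-involutive j))
  xs = map opposite (elems (C N K)) ++ elems K
  disjoint : ∀ {i} → (i ∈ map opposite (elems (C N K))) × (i ∈ elems K) → ⊥
  disjoint (i∈ , i∈K) with j , j∈ , refl ← ∈-map⁻ opposite i∈ = ∈-C⁻ K j∈ i∈K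
  covers : allFin N ⊆ xs
  covers {i} _ with _∈?_ Fin._≟_ i (elems K)
  ... | yes i∈K = ∈-++⁺ʳ (map opposite (elems (C N K))) i∈K
  ... | no  i∉K = ∈-++⁺ˡ (subst (_∈ map opposite (elems (C N K))) (opposite-involutive i)
                    (∈-map⁺ opposite (∈-C⁺ K i∉K)))
  all↭ : xs ↭ allFin N
  all↭ = unique-set⇒↭ (Unique.allFin⁺ N)
    (Unique.++⁺ (Unique.map⁺ opposite-injective (elems-unique (C N K))) (elems-unique K) disjoint)
    covers (λ {i} _ → ∈-allFin i)
  lengths : length xs ≡ len (C N K) + len K
  lengths = trans (length-++ (map opposite (elems (C N K)))) (cong (_+ len K) (length-map opposite (elems (C N K))))

-- The part cancels against its complement to leave `m`, and an index and its opposite account for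
-- `N`. This is the reason for the opposites in `C`.
shifted-complement : ∀ {m N} α → (∀ i → α ! i ≤ m) → (i : Fin N) →
                     suc (shifted α i + shifted (complement m N α) (opposite i)) ≡ m + N
shifted-complement {m} {N} α α≤m i = trans
  (cong (λ x → suc (shifted α i + x)) (cong₂ _+_
    (trans (at-applyDownFrom (λ j → m ∸ α ! j) (opposite i)) (cong (λ j → m ∸ α ! toℕ j) (opposite-involutive i)))
    (cong toℕ (opposite-involutive i))))
  (trans
    (solve 4 (λ a p b i → con 1 :+ ((a :+ p) :+ (b :+ i)) := (a :+ b) :+ (con 1 :+ (i :+ p))) refl
      (α ! toℕ i) (toℕ (opposite i)) (m ∸ α ! toℕ i) (toℕ i))
    (cong₂ _+_ (m+[n∸m]≡n (α≤m (toℕ i))) (suc-opposite i)))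
  where open +-*-Solver

select : ∀ {N} → List ℕ → Partition → Subsequence N
select {N} xs α = mkSubsequence (filter (λ i → _∈?_ _≟_ (shifted α i) xs) (allFin N))
  (Linked.filter⁺ _ Fin.<-trans (Linked.AllPairs⇒Linked (AllPairs.tabulate⁺-< id)))

-- Both sides are strictly decreasing, so it is enough to compare them as sets.
map-select : ∀ {N xs} α → Linked _>_ xs → xs ⊆ seqρ N α → map (shifted α) (elems (select {N} xs α)) ≡ xs
map-select {N} {xs} α xs> xs⊆ = ↭⇒≡ ys> xs> (unique-set⇒↭ (linked->⇒unique xs>) (linked->⇒unique ys>) xs⊆ys ys⊆xs)
  where
  ys> = shifted-> α (select {N} xs α)
  xs⊆ys : xs ⊆ map (shifted α) (elems (select {N} xs α))
  xs⊆ys x∈ with i , refl ← ∈-seqρ⁻ {N} α (xs⊆ x∈) = ∈-map⁺ (shifted α) (∈-filter⁺ _ (∈-allFin i) x∈)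
  ys⊆xs : map (shifted α) (elems (select {N} xs α)) ⊆ xs
  ys⊆xs y∈ with i , i∈ , refl ← ∈-map⁻ (shifted α) y∈ = proj₂ (∈-filter⁻ _ {xs = allFin N} i∈)

-- The map `φ`: values and injectivity.

module _ (l m n : ℕ) (κ : Partition) (κ⊂ : κ ⊂ ⟨ (m + n) ^ l ⟩) where

  IsSubpartition : Partition × Subsequence (n + l) → Set
  IsSubpartition (Λ , K) = Λ ⊂ ⟨ m ^ (n + l) ⟩ × len K ≡ l × sub (n + l) Λ K ≈ κ

  IsFactorization : Partition × Partition → Set
  IsFactorization (μ , ν) = ℓ μ ≤ m × ℓ ν ≤ n × Pointwise _≈_ (μ ⋆⟨ m · n ⟩ ν) (just (κ ′))

  φ : Partition × Subsequence (n + l) → Partition × Partition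
  φ (Λ , K) = Λ ′ , sub (n + l) (complement m (n + l) Λ) (C (n + l) K)

  ℓκ≤l : ℓ κ ≤ l
  ℓκ≤l = ⊂⇒ℓ≤ {κ} {m + n} {l} κ⊂

  κ≤ : ∀ i → κ ! i ≤ m + n
  κ≤ = ⊂⇒!≤ {κ} {m + n} {l} κ⊂

  ℓκ′≤ : ℓ (κ ′) ≤ m + n
  ℓκ′≤ = ℓ′≤ κ (κ≤ 0)

  -- The rectangles around `κ` and `Λ` have the same semiperimeter `m + n + l`, so one reflection
  -- serves both; only the bracketing differs.
  κ′-bound : ∀ {b} → b ∈ seqρ (m + n) (κ ′) → b < m + (n + l)
  κ′-bound {b} b∈ = subst (b <_) (trans (+-comm l (m + n)) (+-assoc m n l))
    (seqρ-bound (κ ′) (′≤ κ ℓκ≤l) b∈)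

  κ-disjoint : ∀ {a b} → a ∈ seqρ l κ → b ∈ seqρ (m + n) (κ ′) → suc (a + b) ≢ m + (n + l)
  κ-disjoint a∈ b∈ eq = dual-disjoint κ a∈ b∈ (trans eq (sym (+-assoc m n l)))

  len-C≡n : ∀ (K : Subsequence (n + l)) → len K ≡ l → len (C (n + l) K) ≡ n
  len-C≡n K lenK = +-cancelʳ-≡ l _ n (trans (cong (len (C (n + l) K) +_) (sym lenK)) (len-C K))

  -- The condition on `sub` in terms of sets: `K` marks in the set of `Λ` exactly the elements of
  -- the set of `κ`.
  selected : ∀ {Λ K} → IsSubpartition (Λ , K) → map (shifted Λ) (elems K) ≡ seqρ l κ
  selected {Λ} {K} (_ , lenK , sub≈κ) =
    trans (sym (seqρ-sub Λ K lenK)) (seqρ-cong l {sub (n + l) Λ K} {κ} sub≈κ)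

  -- Both sides have `m + n` entries, so the inclusion `covered` suffices. An element `b` outside
  -- the set of `Λ ′` is the reflection of some `shifted Λ i`, and `i` turns out to be unmarked.
  φ-↭ : ∀ {Λ K} → IsSubpartition (Λ , K) →
        seqρ (m + n) (κ ′) ↭ seqρ m (Λ ′) ++ seqρ n (proj₂ (φ (Λ , K)))
  φ-↭ {Λ} {K} h@(Λ⊂ , lenK , _) = ↭-sym (unique-⊆-length⇒↭
    (linked->⇒unique (seqρ-> (m + n) (κ ′))) covered
    (≤-reflexive (trans (length-++ (seqρ m (Λ ′)))
      (trans (cong₂ _+_ (length-seqρ m (Λ ′)) (length-seqρ n ν)) (sym (length-seqρ (m + n) (κ ′)))))))
    where
    ν = proj₂ (φ (Λ , K))
    covered : seqρ (m + n) (κ ′) ⊆ seqρ m (Λ ′) ++ seqρ n ν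
    covered {b} b∈ with dual-cover Λ {n + l} {m} Λ⊂ (κ′-bound b∈)
    ... | inj₁ b∈Λ′ = ∈-++⁺ˡ b∈Λ′
    ... | inj₂ (a , a∈ , eq) with i , refl ← ∈-seqρ⁻ {n + l} Λ a∈ = ∈-++⁺ʳ (seqρ m (Λ ′))
      (subst (b ∈_) (sym (seqρ-sub (complement m (n + l) Λ) (C (n + l) K) (len-C≡n K lenK)))
        (subst (_∈ map (shifted (complement m (n + l) Λ)) (elems (C (n + l) K))) b≡
          (∈-map⁺ (shifted (complement m (n + l) Λ)) (∈-C⁺ K i∉K))))
      where
      -- Otherwise `shifted Λ i` would lie in the set of `κ`, and its reflection `b` could not lie
      -- in that of `κ ′`.
      i∉K : i ∉ elems K
      i∉K i∈K = κ-disjoint (subst (shifted Λ i ∈_) (selected {Λ} {K} h) (∈-map⁺ (shifted Λ) i∈K)) b∈ eq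
      -- Both sides are the reflection of `shifted Λ i`.
      b≡ : shifted (complement m (n + l) Λ) (opposite i) ≡ b
      b≡ = +-cancelˡ-≡ (shifted Λ i) _ b (suc-injective
        (trans (shifted-complement Λ (⊂⇒!≤ {Λ} {m} {n + l} Λ⊂) i) (sym eq)))

  φ-factorization : ∀ {x} → IsSubpartition x → IsFactorization (φ x)
  φ-factorization {Λ , K} h@(Λ⊂ , lenK , _) =
    ℓ′≤ Λ (⊂⇒!≤ {Λ} {m} {n + l} Λ⊂ 0) ,
    ≤-trans (ℓ-sub (complement m (n + l) Λ) (C (n + l) K)) (≤-reflexive (len-C≡n K lenK)) ,
    overlap⇒⋆ {m} {n} {Λ ′} {_} {κ ′} (ℓκ′≤ , φ-↭ {Λ} {K} h)

  φ-cong : ∀ {Λ Λ₂ K K₂} → Λ ≈ Λ₂ → elems K ≡ elems K₂ →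
           proj₁ (φ (Λ , K)) ≈ proj₁ (φ (Λ₂ , K₂)) × proj₂ (φ (Λ , K)) ≈ proj₂ (φ (Λ₂ , K₂))
  φ-cong {Λ} {Λ₂} {K} {K₂} Λ≈ K≡ =
    ′-cong {Λ} {Λ₂} Λ≈ ,
    sub-cong (complement m (n + l) Λ) (complement m (n + l) Λ₂) {C (n + l) K} {C (n + l) K₂}
      (complement-cong m (n + l) {Λ} {Λ₂} Λ≈) (C-cong {K = K} {K₂} K≡)

  -- Conjugating recovers `Λ`. The marked values are those of `κ` in both cases, and `shifted Λ` is
  -- injective, so the marked indices agree as well.
  φ-injective : ∀ {Λ Λ₂ K K₂} → IsSubpartition (Λ , K) → IsSubpartition (Λ₂ , K₂) →
                Λ ′ ≈ Λ₂ ′ → Λ ≈ Λ₂ × elems K ≡ elems K₂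
  φ-injective {Λ} {Λ₂} {K} {K₂} h h₂ p = Λ≈ , map-injective (shifted-injective Λ)
    (trans (selected {Λ} {K} h) (trans (sym (selected {Λ₂} {K₂} h₂))
      (map-cong (λ k → cong (_+ toℕ (opposite k)) (sym (Λ≈ (toℕ k)))) (elems K₂))))
    where
    Λ≈ : Λ ≈ Λ₂
    Λ≈ = ′-injective {Λ} {Λ₂} p

  -- Surjectivity of `φ`.

  module Preimage (μ ν : Partition) (h : IsFactorization (μ , ν)) where

    ℓμ = proj₁ h
    ℓν = proj₁ (proj₂ h)

    κ′↭ : seqρ (m + n) (κ ′) ↭ seqρ m μ ++ seqρ n ν
    κ′↭ = ⋆⇒↭ {m} {n} {μ} {ν} {κ ′} (proj₂ (proj₂ h))

    Λ : Partition
    Λ = μ ′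

    seqρ-Λ′ : seqρ m (Λ ′) ≡ seqρ m μ
    seqρ-Λ′ = seqρ-cong m {Λ ′} {μ} (′-involutive μ)

    μ₀≤ : μ ! 0 ≤ n + l
    -- For positive `m` the first shifted part of `μ` is `μ ! 0 + (m - 1)`, and the overlap places
    -- it in the bounded set of `κ ′`. For `m = 0` there is no such entry, but then `μ` is empty.
    -- The auxiliary `k` allows the case split.
    μ₀≤ = bound m ℓμ (λ x∈ → κ′-bound (∈-resp-↭ (↭-sym κ′↭) (∈-++⁺ˡ x∈)))
      where
      bound : ∀ k → ℓ μ ≤ k → (∀ {x} → x ∈ seqρ k μ → x < k + (n + l)) → μ ! 0 ≤ n + l
      bound zero    ℓμ≤0 _ = ≤-trans (≤-reflexive (ℓ≤⇒!≡0 μ ℓμ≤0)) z≤n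
      bound (suc k) _    b = +-cancelʳ-≤ k (μ ! 0) (n + l)
        (≤-trans (s≤s⁻¹ (b (here refl))) (≤-reflexive (+-comm k (n + l))))

    Λ⊂ : Λ ⊂ ⟨ m ^ (n + l) ⟩
    Λ⊂ = ⊂-intro {Λ} {m} {n + l} (′≤ μ ℓμ) (ℓ′≤ μ μ₀≤)

    -- If the reflection of `y` were in the set of `Λ ′`, which is that of `μ`, the overlap would
    -- put it in that of `κ ′`, against `κ-disjoint`. So it is the reflection of an element of `Λ`,
    -- which must be `y`.
    κ⊆Λ : seqρ l κ ⊆ seqρ (n + l) Λ
    κ⊆Λ {y} y∈ with suc-flip (subst (y <_) (+-assoc m n l) (seqρ-bound κ κ≤ y∈))
    ... | flip≡ with dual-cover Λ {n + l} {m} Λ⊂ (≤-trans (s≤s (m≤n+m _ y)) (≤-reflexive flip≡))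
    ...   | inj₁ b∈Λ′ = contradiction flip≡ (κ-disjoint y∈
            (∈-resp-↭ (↭-sym κ′↭) (∈-++⁺ˡ (subst (_ ∈_) seqρ-Λ′ b∈Λ′))))
    ...   | inj₂ (a , a∈ , a≡) = subst (_∈ seqρ (n + l) Λ) (suc-cancel {a} {y} a≡ flip≡) a∈

    K : Subsequence (n + l)
    K = select (seqρ l κ) Λ

    K-selects : map (shifted Λ) (elems K) ≡ seqρ l κ
    K-selects = map-select Λ (seqρ-> l κ) κ⊆Λ

    lenK : len K ≡ l
    lenK = trans (sym (length-map (shifted Λ) (elems K))) (trans (cong length K-selects) (length-seqρ l κ))

    sub≈κ : sub (n + l) Λ K ≈ κ
    sub≈κ = seqρ-injective {l} {sub (n + l) Λ K} {κ}
      (≤-trans (ℓ-sub Λ K) (≤-reflexive lenK)) ℓκ≤l (trans (seqρ-sub Λ K lenK) K-selects)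

    isSubpartition : IsSubpartition (Λ , K)
    isSubpartition = Λ⊂ , lenK , sub≈κ

    φ₂≈ν : proj₂ (φ (Λ , K)) ≈ ν
    φ₂≈ν = seqρ-injective {n} {proj₂ (φ (Λ , K))} {ν}
      (proj₁ (proj₂ (φ-factorization {Λ , K} isSubpartition))) ℓν
      -- The two overlap equations have the same `κ ′` and the same `μ`; cancelling `μ` leaves two
      -- decreasing sequences with the same entries.
      (↭⇒≡ (seqρ-> n (proj₂ (φ (Λ , K)))) (seqρ-> n ν) (++-cancelˡ-↭ (seqρ m μ)
        (↭-trans (↭-reflexive (cong (_++ seqρ n (proj₂ (φ (Λ , K)))) (sym seqρ-Λ′)))
          (↭-trans (↭-sym (φ-↭ {Λ} {K} isSubpartition)) κ′↭))))

proposition4p15 :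
  (l m n : ℕ) (κ : Partition) → κ ⊂ ⟨ (m + n) ^ l ⟩ →
  let pairs₁ = partitionSetoid ×ₛ partitionSetoid
      pairs₂ = partitionSetoid ×ₛ subsequenceSetoid (n + l)
      set₁ = pairs₁ restrictedTo λ (μ , ν) →
               ℓ μ ≤ m × ℓ ν ≤ n × Pointwise _≈_ (μ ⋆⟨ m · n ⟩ ν) (just (κ ′))
      set₂ = pairs₂ restrictedTo λ (Λ , K) →
               Λ ⊂ ⟨ m ^ (n + l) ⟩ × len K ≡ l × sub (n + l) Λ K ≈ κ
  in Σ[ f ∈ Bijection set₂ set₁ ]
       (∀ (x : Setoid.Carrier set₂) →
          let (Λ , K) = proj₁ x in
          Setoid._≈_ pairs₁ (proj₁ (Bijection.to f x))
            (Λ ′ , sub (n + l) (complement m (n + l) Λ) (C (n + l) K)))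
proposition4p15 l m n κ κ⊂ = record
  { to        = λ (x , h) → φ l m n κ κ⊂ x , φ-factorization l m n κ κ⊂ {x} h
  ; cong      = λ {x} {y} p → congruent {x} {y} p
  ; bijective =
      (λ { {(Λ , K) , h} {(Λ₂ , K₂) , h₂} p → φ-injective l m n κ κ⊂ {Λ} {Λ₂} {K} {K₂} h h₂ (proj₁ p) }) ,
      λ ((μ , ν) , h) → let open Preimage l m n κ κ⊂ μ ν h in
        -- Surjectivity is required for every `z` equal to the preimage, not only for the preimage
        -- itself, hence the detour through `congruent`.
        ((Λ , K) , isSubpartition) , λ {z} z≈ →
          let p , q = congruent {z} {(Λ , K) , isSubpartition} z≈
          in (λ i → trans (p i) (′-involutive μ i)) , λ i → trans (q i) (φ₂≈ν i)
  } , λ _ → (λ _ → refl) , λ _ → refl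
  where
  congruent : ∀ {x y : ∃ (IsSubpartition l m n κ κ⊂)} →
              proj₁ (proj₁ x) ≈ proj₁ (proj₁ y) × elems (proj₂ (proj₁ x)) ≡ elems (proj₂ (proj₁ y)) →
              proj₁ (φ l m n κ κ⊂ (proj₁ x)) ≈ proj₁ (φ l m n κ κ⊂ (proj₁ y)) ×
              proj₂ (φ l m n κ κ⊂ (proj₁ x)) ≈ proj₂ (φ l m n κ κ⊂ (proj₁ y))
  congruent {(Λ , K) , _} {(Λ₂ , K₂) , _} (p , q) = φ-cong l m n κ κ⊂ {Λ} {Λ₂} {K} {K₂} p q
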